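{- If $n\ge 5$ is an odd integer, then $$\chi(Q_{n}^{[\natural n-3]})\le \chi(J(n,(n-3)/2,0))+\chi(J(n,(n-1)/2,1))+1\le \chi(K(7,3,1))+6.$$
   Context: $Q_n^{[\natural p]}$ is the graph on $\{0,1\}^n$ in which two vertices are adjacent iff they differ in exactly $p$ coordinates. For integers $i\le k\le n$, the generalized Johnson graph $J(n,k,i)$ has vertex set $\{A\subseteq\{1,\ldots,n\}: |A|=k\}$ and edge set $\{AB: |A\cap B|=i\}$; the generalized Kneser graph $K(n,k,i)$ has the same vertex set, two distinct vertices $A,B$ being adjacent iff $|A\cap B|\le i$. $\chi$ denotes the chromatic number. -}

module Defs where

open import Level using (0ℓ)
open import Data.Nat using (ℕ; zero; suc; _+_; _≤_)
open import Data.Bool using (Bool; true; false; _xor_)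
open import Data.Vec using (Vec; []; _∷_)
open import Data.Fin using (Fin)
open import Data.Fin.Subset using (Subset; _∩_; ∣_∣)
open import Data.Product using (Σ; _×_; proj₁)
open import Relation.Binary.PropositionalEquality using (_≡_; _≢_)

record Graph : Set₁ where
  field
    V   : Set
    Adj : V → V → Set
open Graph public

Colorable : Graph → ℕ → Set
Colorable G k = Σ (V G → Fin k) λ c → ∀ u v → Adj G u v → c u ≢ c v

IsChromaticNumber : Graph → ℕ → Set
IsChromaticNumber G k = Colorable G k × (∀ j → Colorable G j → k ≤ j)

hamming : ∀ {n} → Vec Bool n → Vec Bool n → ℕ
hamming []       []       = 0
hamming (x ∷ xs) (y ∷ ys) with x xor y
... | true  = suc (hamming xs ys)
... | false = hamming xs ys

DistGraphCube : ℕ → ℕ → Graph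
DistGraphCube n p = record { V = Vec Bool n ; Adj = λ x y → hamming x y ≡ p }

KSubset : ℕ → ℕ → Set
KSubset n k = Σ (Subset n) λ A → ∣ A ∣ ≡ k

Johnson : ℕ → ℕ → ℕ → Graph
Johnson n k i = record { V = KSubset n k ; Adj = λ A B → ∣ proj₁ A ∩ proj₁ B ∣ ≡ i }

Kneser : ℕ → ℕ → ℕ → Graph
Kneser n k i = record
  { V = KSubset n k
  ; Adj = λ A B → (proj₁ A ≢ proj₁ B) × (∣ proj₁ A ∩ proj₁ B ∣ ≤ i) }

{-# OPTIONS --safe #-}

-- Write n = 2k + 3.  Replacing a vertex of the cube by its complement if
-- necessary makes it a set of size at most k + 1, and two adjacent vertices
-- whose representatives have sizes of equal parity are either both or neither
-- complemented, because n is odd.  So the representatives are again at distance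
-- 2k, and within one parity class this forces two disjoint k-sets, two
-- (k + 1)-sets meeting in one point, or a (k + 1)-set and a disjoint
-- (k - 1)-set.  Hence a colours suffice for the class of k, and b + 1 for the
-- class of k + 1.
--
-- For the second inequality, the Kneser graph J(2k+3, k, 0) has the usual
-- 5-colouring by least elements, and J(2k+3, k+1, 1) maps to K(7, 3, 1): for
-- k ≥ 2 by iterating a Stahl-type homomorphism K(n+2, k+1, i) → K(n, k, i), and
-- for k = 1 through the Fano plane, which is a 7-clique of K(7, 3, 1).

module Submission where

open import Defs
open import Data.Bool using (true; false)
open import Data.Fin using (Fin; zero; suc; join; splitAt)
open import Data.Fin.Properties using (splitAt-join; suc-injective)
open import Data.Fin.Subset using (Subset; inside; outside; _∩_; ∁; ∣_∣) renaming (⊥ to ∅)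
open import Data.Fin.Subset.Properties using (anySubset?; ∣⊥∣≡0; ∩-comm; ∩-idem)
open import Data.Nat using (ℕ; zero; suc; _+_; _*_; _∸_; _≤_; _<_; z≤n; s≤s; s≤s⁻¹; parity; _≟_; _≤?_)
open import Data.Nat.GeneralisedArithmetic using (iterate)
open import Data.Nat.Properties hiding (_≟_; _≤?_; suc-injective)
open import Data.Nat.Tactic.RingSolver using (solve-∀)
open import Data.Parity.Base as ℙ using (Parity; 0ℙ; 1ℙ; _⁻¹)
open import Data.Parity.Properties as ℙ using (+-homo-+; p+p≡0ℙ; p≢p⁻¹)
open import Data.Product using (_×_; _,_; proj₁; proj₂; Σ; ∃₂)
open import Data.Sum using (_⊎_; inj₁; inj₂; map₁)
open import Data.Sum.Properties using (inj₁-injective; inj₂-injective)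
open import Data.Vec using ([]; _∷_; _∷ʳ_)
open import Data.Vec.Properties using (≡-dec)
import Data.Bool.Properties as Bool
open import Function using (_∘_)
open import Relation.Binary.PropositionalEquality
open import Relation.Nullary using (¬_; Dec; yes; no; contradiction; ¬?; _×-dec_)
open import Relation.Nullary.Decidable using (from-no; decidable-stable)

private
  variable
    n k i c : ℕ
    G H : Graph

-- Sizes of intersections, symmetric differences and complements.

∣∩∣-upper : (x y : Subset n) → ∣ x ∣ + ∣ y ∣ ≤ n + ∣ x ∩ y ∣
∣∩∣-upper [] [] = z≤n
∣∩∣-upper {suc n} (true ∷ x) (true ∷ y)
  rewrite +-suc ∣ x ∣ ∣ y ∣ | +-suc n ∣ x ∩ y ∣ = s≤s (s≤s (∣∩∣-upper x y))
∣∩∣-upper (true ∷ x) (false ∷ y) = s≤s (∣∩∣-upper x y)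
∣∩∣-upper (false ∷ x) (true ∷ y)
  rewrite +-suc ∣ x ∣ ∣ y ∣ = s≤s (∣∩∣-upper x y)
∣∩∣-upper (false ∷ x) (false ∷ y) = m≤n⇒m≤1+n (∣∩∣-upper x y)

-- A coordinate in exactly one set adds one to each side, a shared one adds two. The later size and
-- parity arguments about edges rest on this count.
∣∣+∣∣≡hamming+2∣∩∣ : (x y : Subset n) →
  ∣ x ∣ + ∣ y ∣ ≡ hamming x y + (∣ x ∩ y ∣ + ∣ x ∩ y ∣)
∣∣+∣∣≡hamming+2∣∩∣ [] [] = refl
∣∣+∣∣≡hamming+2∣∩∣ (true ∷ x) (true ∷ y)
  rewrite +-suc ∣ x ∣ ∣ y ∣
        | +-suc ∣ x ∩ y ∣ ∣ x ∩ y ∣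
        | +-suc (hamming x y) (suc (∣ x ∩ y ∣ + ∣ x ∩ y ∣))
        | +-suc (hamming x y) (∣ x ∩ y ∣ + ∣ x ∩ y ∣) = cong (2 +_) (∣∣+∣∣≡hamming+2∣∩∣ x y)
∣∣+∣∣≡hamming+2∣∩∣ (true ∷ x) (false ∷ y) = cong suc (∣∣+∣∣≡hamming+2∣∩∣ x y)
∣∣+∣∣≡hamming+2∣∩∣ (false ∷ x) (true ∷ y)
  rewrite +-suc ∣ x ∣ ∣ y ∣ = cong suc (∣∣+∣∣≡hamming+2∣∩∣ x y)
∣∣+∣∣≡hamming+2∣∩∣ (false ∷ x) (false ∷ y) = ∣∣+∣∣≡hamming+2∣∩∣ x y

hamming-∁ : (x y : Subset n) → hamming (∁ x) (∁ y) ≡ hamming x y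
hamming-∁ [] [] = refl
hamming-∁ (true ∷ x) (true ∷ y) = hamming-∁ x y
hamming-∁ (true ∷ x) (false ∷ y) = cong suc (hamming-∁ x y)
hamming-∁ (false ∷ x) (true ∷ y) = cong suc (hamming-∁ x y)
hamming-∁ (false ∷ x) (false ∷ y) = hamming-∁ x y

∣x∣+∣∁x∣≡n : (x : Subset n) → ∣ x ∣ + ∣ ∁ x ∣ ≡ n
∣x∣+∣∁x∣≡n [] = refl
∣x∣+∣∁x∣≡n (true ∷ x) = cong suc (∣x∣+∣∁x∣≡n x)
∣x∣+∣∁x∣≡n (false ∷ x) = trans (+-suc ∣ x ∣ ∣ ∁ x ∣) (cong suc (∣x∣+∣∁x∣≡n x))

subsetOfSize : k ≤ n → KSubset n k
subsetOfSize {n = n} z≤n = ∅ , ∣⊥∣≡0 n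
subsetOfSize (s≤s k≤n) with subsetOfSize k≤n
... | x , ∣x∣≡k = inside ∷ x , cong suc ∣x∣≡k

-- Parity of sums.

parity-suc : ∀ m → parity (suc m) ≡ parity m ⁻¹
parity-suc m = +-homo-+ 1 m

parity-double : ∀ m → parity (m + m) ≡ 0ℙ
parity-double m = trans (+-homo-+ m m) (p+p≡0ℙ (parity m))

sum-even⇒parity-≡ : ∀ l m → parity (l + m) ≡ 0ℙ → parity l ≡ parity m
sum-even⇒parity-≡ l m eq = cancel (parity l) (parity m) (trans (sym (+-homo-+ l m)) eq)
  where
  cancel : ∀ p q → p ℙ.+ q ≡ 0ℙ → p ≡ q
  cancel 0ℙ 0ℙ _ = refl
  cancel 1ℙ 1ℙ _ = refl

parity-≡⇒sum-even : ∀ l m → parity l ≡ parity m → parity (l + m) ≡ 0ℙ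
parity-≡⇒sum-even l m eq = begin
  parity (l + m)           ≡⟨ +-homo-+ l m ⟩
  parity l ℙ.+ parity m    ≡⟨ cong (ℙ._+ parity m) eq ⟩
  parity m ℙ.+ parity m    ≡⟨ p+p≡0ℙ (parity m) ⟩
  0ℙ                       ∎
  where open ≡-Reasoning

double-injective : ∀ l m → l + l ≡ m + m → l ≡ m
double-injective zero zero _ = refl
double-injective (suc l) (suc m) eq = cong suc (double-injective l m
  (cong (_∸ 2) (subst₂ _≡_ (cong suc (+-suc l l)) (cong suc (+-suc m m)) eq)))

-- Colouring the cube.

module CubeColouring {n k a b : ℕ} (n≡ : n ≡ 3 + (k + k))
  (A : Colorable (Johnson n k 0) a) (B : Colorable (Johnson n (suc k) 1) b) where

  Colour : Set
  Colour = (Fin a ⊎ Fin b) ⊎ Fin 1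

  k≤n : k ≤ n
  k≤n = subst (k ≤_) (sym n≡) (m≤n⇒m≤o+n 3 (m≤m+n k k))

  lowColour : (r : Subset n) → Dec (∣ r ∣ ≡ k) → Fin a
  lowColour r (yes eq) = proj₁ A (r , eq)
  -- Any colour will do: a set smaller than `k` is never at distance `k + k` from a set of size at
  -- most `k`. Colouring some vertex shows that `Fin a` is inhabited.
  lowColour r (no _)   = proj₁ A (subsetOfSize k≤n)

  highColour : (r : Subset n) → Dec (∣ r ∣ ≡ suc k) → Colour
  highColour r (yes eq) = inj₁ (inj₂ (proj₁ B (r , eq)))
  -- In this parity class the other representatives have fewer than `k` points. No two of them are
  -- at distance `k + k`, so one colour serves them all.
  highColour r (no _)   = inj₂ zero

  classColour : (r : Subset n) → Dec (parity ∣ r ∣ ≡ parity (suc k)) → Colour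
  classColour r (yes _) = highColour r (∣ r ∣ ≟ suc k)
  classColour r (no _)  = inj₁ (inj₁ (lowColour r (∣ r ∣ ≟ k)))

  distance-2k⇒large : (r s : Subset n) → hamming r s ≡ k + k → k + k ≤ ∣ r ∣ + ∣ s ∣
  distance-2k⇒large r s d = subst₂ _≤_ d (sym (∣∣+∣∣≡hamming+2∣∩∣ r s)) (m≤m+n _ _)

  sum-2k⇒disjoint : (r s : Subset n) → hamming r s ≡ k + k →
    ∣ r ∣ ≡ k → ∣ s ∣ ≡ k → ∣ r ∩ s ∣ ≡ 0
  sum-2k⇒disjoint r s d r≡ s≡ = double-injective _ 0 (+-cancelˡ-≡ (k + k) _ _ (begin
    k + k + (∣ r ∩ s ∣ + ∣ r ∩ s ∣)         ≡⟨ cong (_+ (∣ r ∩ s ∣ + ∣ r ∩ s ∣)) d ⟨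
    hamming r s + (∣ r ∩ s ∣ + ∣ r ∩ s ∣)   ≡⟨ ∣∣+∣∣≡hamming+2∣∩∣ r s ⟨
    ∣ r ∣ + ∣ s ∣                           ≡⟨ cong₂ _+_ r≡ s≡ ⟩
    k + k                                   ≡⟨ +-identityʳ (k + k) ⟨
    k + k + 0                               ∎))
    where open ≡-Reasoning

  sum-2k+2⇒meet-in-1 : (r s : Subset n) → hamming r s ≡ k + k →
    ∣ r ∣ ≡ suc k → ∣ s ∣ ≡ suc k → ∣ r ∩ s ∣ ≡ 1
  sum-2k+2⇒meet-in-1 r s d r≡ s≡ = double-injective _ 1 (+-cancelˡ-≡ (k + k) _ _ (begin
    k + k + (∣ r ∩ s ∣ + ∣ r ∩ s ∣)         ≡⟨ cong (_+ (∣ r ∩ s ∣ + ∣ r ∩ s ∣)) d ⟨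
    hamming r s + (∣ r ∩ s ∣ + ∣ r ∩ s ∣)   ≡⟨ ∣∣+∣∣≡hamming+2∣∩∣ r s ⟨
    ∣ r ∣ + ∣ s ∣                           ≡⟨ cong₂ _+_ r≡ s≡ ⟩
    suc k + suc k                           ≡⟨ shift k ⟩
    k + k + 2                               ∎))
    where
    open ≡-Reasoning
    shift : ∀ j → suc j + suc j ≡ j + j + 2
    shift = solve-∀

  lowColour-proper : (r s : Subset n) → hamming r s ≡ k + k → ∣ r ∣ ≤ k → ∣ s ∣ ≤ k →
    ∀ r? s? → lowColour r r? ≢ lowColour s s?
  lowColour-proper r s d r≤ s≤ (yes r≡) (yes s≡) =
    proj₂ A _ _ (sum-2k⇒disjoint r s d r≡ s≡)
  lowColour-proper r s d r≤ s≤ (no r≢) _ _ =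
    <⇒≱ (+-mono-<-≤ (≤∧≢⇒< r≤ r≢) s≤) (distance-2k⇒large r s d)
  lowColour-proper r s d r≤ s≤ (yes _) (no s≢) _ =
    <⇒≱ (+-mono-≤-< r≤ (≤∧≢⇒< s≤ s≢)) (distance-2k⇒large r s d)

  parity-suc≢ : ∀ {l} → parity l ≡ parity (suc k) → l ≢ k
  parity-suc≢ eq refl = p≢p⁻¹ (parity k) (trans eq (parity-suc k))

  high⇒<k : (r : Subset n) → ∣ r ∣ ≤ suc k → ∣ r ∣ ≢ suc k →
    parity ∣ r ∣ ≡ parity (suc k) → ∣ r ∣ < k
  high⇒<k r r≤ r≢ eq = ≤∧≢⇒< (s≤s⁻¹ (≤∧≢⇒< r≤ r≢)) (parity-suc≢ eq)

  highColour-proper : (r s : Subset n) → hamming r s ≡ k + k →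
    ∣ r ∣ ≤ suc k → ∣ s ∣ ≤ suc k →
    parity ∣ r ∣ ≡ parity (suc k) → parity ∣ s ∣ ≡ parity (suc k) →
    ∀ r? s? → highColour r r? ≢ highColour s s?
  highColour-proper r s d _ _ _ _ (yes r≡) (yes s≡) eq =
    proj₂ B _ _ (sum-2k+2⇒meet-in-1 r s d r≡ s≡) (inj₂-injective (inj₁-injective eq))
  highColour-proper r s d r≤ s≤ pr ps (no r≢) (no s≢) _ =
    <⇒≱ (+-mono-< (high⇒<k r r≤ r≢ pr) (high⇒<k s s≤ s≢ ps)) (distance-2k⇒large r s d)

  low⇒≤k : (r : Subset n) → ∣ r ∣ ≤ suc k → parity ∣ r ∣ ≢ parity (suc k) → ∣ r ∣ ≤ k
  low⇒≤k r r≤ p≢ = s≤s⁻¹ (≤∧≢⇒< r≤ (p≢ ∘ cong parity))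

  highColour≢low : ∀ r r? {l} → highColour r r? ≢ inj₁ (inj₁ l)
  highColour≢low r (yes _) ()
  highColour≢low r (no _) ()

  -- The distance is assumed only for equal parities because folding preserves it only then; the two
  -- parity classes use disjoint sets of colours.
  classColour-proper : (r s : Subset n) →
    (parity ∣ r ∣ ≡ parity ∣ s ∣ → hamming r s ≡ k + k) →
    ∣ r ∣ ≤ suc k → ∣ s ∣ ≤ suc k →
    ∀ r? s? → classColour r r? ≢ classColour s s?
  classColour-proper r s d r≤ s≤ (yes pr) (yes ps) =
    highColour-proper r s (d (trans pr (sym ps))) r≤ s≤ pr ps (∣ r ∣ ≟ suc k) (∣ s ∣ ≟ suc k)
  classColour-proper r s d r≤ s≤ (yes pr) (no ps) = highColour≢low r (∣ r ∣ ≟ suc k)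
  classColour-proper r s d r≤ s≤ (no pr) (yes ps) = highColour≢low s (∣ s ∣ ≟ suc k) ∘ sym
  classColour-proper r s d r≤ s≤ (no pr) (no ps) eq =
    lowColour-proper r s (d (two-classes pr ps)) (low⇒≤k r r≤ pr) (low⇒≤k s s≤ ps)
      (∣ r ∣ ≟ k) (∣ s ∣ ≟ k) (inj₁-injective (inj₁-injective eq))
    where
    two-classes : ∀ {p q t : Parity} → p ≢ t → q ≢ t → p ≡ q
    two-classes {0ℙ} {0ℙ} _ _ = refl
    two-classes {1ℙ} {1ℙ} _ _ = refl
    two-classes {0ℙ} {1ℙ} {0ℙ} p≢ _ = contradiction refl p≢
    two-classes {0ℙ} {1ℙ} {1ℙ} _ q≢ = contradiction refl q≢
    two-classes {1ℙ} {0ℙ} {0ℙ} _ q≢ = contradiction refl q≢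
    two-classes {1ℙ} {0ℙ} {1ℙ} p≢ _ = contradiction refl p≢

  fold : (x : Subset n) → Dec (∣ x ∣ ≤ suc k) → Subset n
  fold x (yes _) = x
  fold x (no _)  = ∁ x

  ∣fold∣≤ : ∀ x x? → ∣ fold x x? ∣ ≤ suc k
  ∣fold∣≤ x (yes x≤) = x≤
  -- Now `x` has at least `2 + k` of the `3 + (k + k)` points, which leaves at most `suc k` for the
  -- complement.
  ∣fold∣≤ x (no x≰) = +-cancelˡ-≤ (2 + k) _ _ (begin
    2 + k + ∣ ∁ x ∣    ≤⟨ +-monoˡ-≤ ∣ ∁ x ∣ (≰⇒> x≰) ⟩
    ∣ x ∣ + ∣ ∁ x ∣    ≡⟨ ∣x∣+∣∁x∣≡n x ⟩
    n                  ≡⟨ n≡ ⟩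
    3 + (k + k)        ≡⟨ cong (2 +_) (+-suc k k) ⟨
    2 + k + suc k      ∎)
    where open ≤-Reasoning

  adjacent⇒parity-≡ : (x y : Subset n) → hamming x y ≡ k + k → parity ∣ x ∣ ≡ parity ∣ y ∣
  adjacent⇒parity-≡ x y d = sum-even⇒parity-≡ ∣ x ∣ ∣ y ∣ (begin
    parity (∣ x ∣ + ∣ y ∣)                           ≡⟨ cong parity (∣∣+∣∣≡hamming+2∣∩∣ x y) ⟩
    parity (hamming x y + (∣ x ∩ y ∣ + ∣ x ∩ y ∣))   ≡⟨ parity-≡⇒sum-even (hamming x y) _
                                                         (trans (cong parity d) (trans (parity-double k) (sym (parity-double ∣ x ∩ y ∣)))) ⟩
    0ℙ                                               ∎)
    where open ≡-Reasoning

  parity-∁ : (x : Subset n) → parity ∣ x ∣ ≢ parity ∣ ∁ x ∣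
  parity-∁ x eq = contradiction (begin
    0ℙ                          ≡⟨ parity-≡⇒sum-even ∣ x ∣ ∣ ∁ x ∣ eq ⟨
    parity (∣ x ∣ + ∣ ∁ x ∣)    ≡⟨ cong parity (trans (∣x∣+∣∁x∣≡n x) n≡) ⟩
    -- `parity` recurses in steps of two, so `parity (3 + (k + k))` reduces to this.
    parity (suc (k + k))        ≡⟨ parity-suc (k + k) ⟩
    parity (k + k) ⁻¹           ≡⟨ cong _⁻¹ (parity-double k) ⟩
    1ℙ                          ∎) λ ()
    where open ≡-Reasoning

  -- Adjacent vertices have sizes of equal parity, and complementing just one of them would make the
  -- parities differ.
  hamming-fold : ∀ x y x? y? → hamming x y ≡ k + k →
    parity ∣ fold x x? ∣ ≡ parity ∣ fold y y? ∣ → hamming (fold x x?) (fold y y?) ≡ k + k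
  hamming-fold x y (yes _) (yes _) d _ = d
  hamming-fold x y (no _) (no _) d _ = trans (hamming-∁ x y) d
  hamming-fold x y (yes _) (no _) d eq =
    contradiction (trans (sym (adjacent⇒parity-≡ x y d)) eq) (parity-∁ y)
  hamming-fold x y (no _) (yes _) d eq =
    contradiction (trans (adjacent⇒parity-≡ x y d) (sym eq)) (parity-∁ x)

  representative : Subset n → Subset n
  representative x = fold x (∣ x ∣ ≤? suc k)

  colour : Subset n → Colour
  colour x = classColour (representative x) (parity ∣ representative x ∣ ℙ.≟ parity (suc k))

  colour-proper : ∀ x y → hamming x y ≡ k + k → colour x ≢ colour y
  colour-proper x y d = classColour-proper (representative x) (representative y)
    (hamming-fold x y (∣ x ∣ ≤? suc k) (∣ y ∣ ≤? suc k) d)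
    (∣fold∣≤ x (∣ x ∣ ≤? suc k)) (∣fold∣≤ y (∣ y ∣ ≤? suc k))
    (parity ∣ representative x ∣ ℙ.≟ parity (suc k)) (parity ∣ representative y ∣ ℙ.≟ parity (suc k))

  join-injective : ∀ l m u v → join l m u ≡ join l m v → u ≡ v
  join-injective l m u v eq =
    trans (sym (splitAt-join l m u)) (trans (cong (splitAt l) eq) (splitAt-join l m v))

  encode : Colour → Fin (a + b + 1)
  encode u = join (a + b) 1 (map₁ (join a b) u)

  encode-injective : ∀ u v → encode u ≡ encode v → u ≡ v
  encode-injective u v = map₁-injective u v ∘ join-injective (a + b) 1 (map₁ (join a b) u) (map₁ (join a b) v)
    where
    map₁-injective : ∀ u v → map₁ (join a b) u ≡ map₁ {B = Fin 1} (join a b) v → u ≡ v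
    map₁-injective (inj₁ u) (inj₁ v) eq = cong inj₁ (join-injective a b u v (inj₁-injective eq))
    map₁-injective (inj₂ u) (inj₂ .u) refl = refl

  cube-colorable : Colorable (DistGraphCube n (k + k)) (a + b + 1)
  cube-colorable = encode ∘ colour , λ x y d → colour-proper x y d ∘ encode-injective (colour x) (colour y)

-- Homomorphisms, and five colours for the disjointness graph.

Homomorphism : Graph → Graph → Set
Homomorphism G H = Σ (V G → V H) λ f → ∀ u v → Adj G u v → Adj H (f u) (f v)

pullback : Homomorphism G H → Colorable H c → Colorable G c
pullback (f , f-adj) (col , proper) = col ∘ f , λ u v uv → proper _ _ (f-adj u v uv)

-- A new point costs one colour: give that colour to all sets containing it.
johnson₀-extend : Colorable (Johnson n k 0) c → Colorable (Johnson (suc n) k 0) (suc c)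
johnson₀-extend {n} {k} {c} (col , proper) = col′ , proper′
  where
  col′ : KSubset (suc n) k → Fin (suc c)
  col′ (true ∷ x , _) = zero
  col′ (false ∷ x , eq) = suc (col (x , eq))
  proper′ : ∀ u v → ∣ proj₁ u ∩ proj₁ v ∣ ≡ 0 → col′ u ≢ col′ v
  proper′ (true ∷ _ , _) (true ∷ _ , _) ()
  proper′ (true ∷ _ , _) (false ∷ _ , _) _ ()
  proper′ (false ∷ _ , _) (true ∷ _ , _) _ ()
  proper′ (false ∷ _ , _) (false ∷ _ , _) uv = proper _ _ uv ∘ suc-injective

-- Two disjoint `k`-sets need `k + k` points, so there are no edges.
johnson₀-1-colorable : n < k + k → Colorable (Johnson n k 0) 1
johnson₀-1-colorable {n} n<2k = (λ _ → zero) , λ (x , x≡) (y , y≡) xy _ →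
  <⇒≱ n<2k (subst₂ _≤_ (cong₂ _+_ x≡ y≡) (trans (cong (n +_) xy) (+-identityʳ n)) (∣∩∣-upper x y))

-- Four points take one colour each; among the remaining `1 + (j + j)` points any two sets of size
-- `suc j` meet.
kneser-5-colorable : ∀ j → Colorable (Johnson (5 + (j + j)) (suc j) 0) 5
kneser-5-colorable j = johnson₀-extend (johnson₀-extend (johnson₀-extend (johnson₀-extend
  (johnson₀-1-colorable (≤-reflexive (cong suc (sym (+-suc j j))))))))

-- The Stahl-type homomorphism.

addFirst : Subset n → Subset n
addFirst [] = []
addFirst (true ∷ x) = true ∷ addFirst x
addFirst (false ∷ x) = true ∷ x

dropFirst : Subset n → Subset n
dropFirst [] = []
dropFirst (true ∷ x) = false ∷ x
dropFirst (false ∷ x) = false ∷ dropFirst x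

∣addFirst∣ : (x : Subset n) → ∣ x ∣ < n → ∣ addFirst x ∣ ≡ suc ∣ x ∣
∣addFirst∣ (true ∷ x) x<n = cong suc (∣addFirst∣ x (s≤s⁻¹ x<n))
∣addFirst∣ (false ∷ x) _ = refl

∣dropFirst∣ : (x : Subset n) → ∣ x ∣ ≡ suc k → ∣ dropFirst x ∣ ≡ k
∣dropFirst∣ (true ∷ x) refl = refl
∣dropFirst∣ (false ∷ x) eq = ∣dropFirst∣ x eq

addFirst-∩ : (x y : Subset n) → ∣ addFirst x ∩ y ∣ ≤ suc ∣ x ∩ y ∣
addFirst-∩ [] [] = z≤n
addFirst-∩ (true ∷ x) (true ∷ y) = s≤s (addFirst-∩ x y)
addFirst-∩ (true ∷ x) (false ∷ y) = addFirst-∩ x y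
addFirst-∩ (false ∷ x) (true ∷ y) = ≤-refl
addFirst-∩ (false ∷ x) (false ∷ y) = n≤1+n _

∩-addFirst : (x y : Subset n) → ∣ x ∩ addFirst y ∣ ≤ suc ∣ x ∩ y ∣
∩-addFirst x y rewrite ∩-comm x (addFirst y) | ∩-comm x y = addFirst-∩ y x

dropFirst-∩ : (x y : Subset n) → ∣ dropFirst x ∩ y ∣ ≤ ∣ x ∩ y ∣
dropFirst-∩ [] [] = z≤n
dropFirst-∩ (true ∷ x) (true ∷ y) = n≤1+n _
dropFirst-∩ (true ∷ x) (false ∷ y) = ≤-refl
dropFirst-∩ (false ∷ x) (_ ∷ y) = dropFirst-∩ x y

∩-dropFirst : (x y : Subset n) → ∣ x ∩ dropFirst y ∣ ≤ ∣ x ∩ y ∣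
∩-dropFirst x y rewrite ∩-comm x (dropFirst y) | ∩-comm x y = dropFirst-∩ y x

-- If the point added to x survives in dropFirst y, then the smaller point
-- dropped from y was already in x, which compensates for it.
addFirst-∩-dropFirst : (x y : Subset n) → ∣ addFirst x ∩ dropFirst y ∣ ≤ ∣ x ∩ y ∣
addFirst-∩-dropFirst [] [] = z≤n
addFirst-∩-dropFirst (true ∷ x) (true ∷ y) = addFirst-∩ x y
addFirst-∩-dropFirst (true ∷ x) (false ∷ y) = addFirst-∩-dropFirst x y
addFirst-∩-dropFirst (false ∷ x) (true ∷ y) = ≤-refl
addFirst-∩-dropFirst (false ∷ x) (false ∷ y) = ∩-dropFirst x y

-- The first two coordinates are the points n + 1 and n + 2 being deleted.
stahl : Subset (2 + n) → Subset n
stahl (true  ∷ true  ∷ x) = addFirst x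
stahl (true  ∷ false ∷ x) = x
stahl (false ∷ true  ∷ x) = x
stahl (false ∷ false ∷ x) = dropFirst x

-- A set losing both deleted points regains one, and a set losing neither gives one up. The bound
-- `k ≤ n` guarantees a missing point to regain, since `addFirst` fixes the full set.
∣stahl∣ : k ≤ n → (x : Subset (2 + n)) → ∣ x ∣ ≡ suc k → ∣ stahl x ∣ ≡ k
∣stahl∣ k≤n (true  ∷ true  ∷ x) refl = ∣addFirst∣ x k≤n
∣stahl∣ _   (true  ∷ false ∷ x) refl = refl
∣stahl∣ _   (false ∷ true  ∷ x) refl = refl
∣stahl∣ _   (false ∷ false ∷ x) eq = ∣dropFirst∣ x eq

-- Each added point is paid for by a deleted common point, except when one set adds and the other
-- drops, where `addFirst-∩-dropFirst` applies.
stahl-∩ : (x y : Subset (2 + n)) → ∣ stahl x ∩ stahl y ∣ ≤ ∣ x ∩ y ∣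
stahl-∩ (true  ∷ true  ∷ x) (true  ∷ true  ∷ y) =
  ≤-trans (addFirst-∩ x (addFirst y)) (s≤s (∩-addFirst x y))
stahl-∩ (true  ∷ true  ∷ x) (true  ∷ false ∷ y) = addFirst-∩ x y
stahl-∩ (true  ∷ true  ∷ x) (false ∷ true  ∷ y) = addFirst-∩ x y
stahl-∩ (true  ∷ true  ∷ x) (false ∷ false ∷ y) = addFirst-∩-dropFirst x y
stahl-∩ (true  ∷ false ∷ x) (true  ∷ true  ∷ y) = ∩-addFirst x y
stahl-∩ (true  ∷ false ∷ x) (true  ∷ false ∷ y) = n≤1+n _
stahl-∩ (true  ∷ false ∷ x) (false ∷ true  ∷ y) = ≤-refl
stahl-∩ (false ∷ true  ∷ x) (true  ∷ true  ∷ y) = ∩-addFirst x y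
stahl-∩ (false ∷ true  ∷ x) (true  ∷ false ∷ y) = ≤-refl
stahl-∩ (false ∷ true  ∷ x) (false ∷ true  ∷ y) = n≤1+n _
stahl-∩ (true  ∷ false ∷ x) (false ∷ false ∷ y) = ∩-dropFirst x y
stahl-∩ (false ∷ true  ∷ x) (false ∷ false ∷ y) = ∩-dropFirst x y
stahl-∩ (false ∷ false ∷ x) (true  ∷ true  ∷ y)
  rewrite ∩-comm (dropFirst x) (addFirst y) | ∩-comm x y = addFirst-∩-dropFirst y x
stahl-∩ (false ∷ false ∷ x) (true  ∷ false ∷ y) = dropFirst-∩ x y
stahl-∩ (false ∷ false ∷ x) (false ∷ true  ∷ y) = dropFirst-∩ x y
stahl-∩ (false ∷ false ∷ x) (false ∷ false ∷ y) =
  ≤-trans (dropFirst-∩ x (dropFirst y)) (∩-dropFirst x y)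

-- Images of adjacent sets stay distinct because equal ones would meet in `k` points, more than `i`.
stahl-homomorphism : i < k → k ≤ n → Homomorphism (Kneser (2 + n) (suc k) i) (Kneser n k i)
stahl-homomorphism {i} {k} i<k k≤n =
  (λ (x , x≡) → stahl x , ∣stahl∣ k≤n x x≡) ,
  λ (x , x≡) (y , _) (_ , xy≤i) →
    let fxy≤i = ≤-trans (stahl-∩ x y) xy≤i in
    (λ fx≡fy → <⇒≱ i<k (begin
      k                        ≡⟨ ∣stahl∣ k≤n x x≡ ⟨
      ∣ stahl x ∣              ≡⟨ cong ∣_∣ (∩-idem (stahl x)) ⟨
      ∣ stahl x ∩ stahl x ∣    ≡⟨ cong (λ z → ∣ stahl x ∩ z ∣) fx≡fy ⟩
      ∣ stahl x ∩ stahl y ∣    ≤⟨ fxy≤i ⟩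
      i                        ∎)) ,
    fxy≤i
  where open ≤-Reasoning

-- Reduction to K(7, 3, 1).

kneser-7-3-1-bounds : Colorable (Kneser 7 3 1) c →
  ∀ j → Colorable (Kneser (7 + (j + j)) (3 + j) 1) c
kneser-7-3-1-bounds col zero = col
kneser-7-3-1-bounds {c} col (suc j) =
  -- `suc j + suc j` unfolds only to `suc (j + suc j)`; moving the inner successor out exposes the
  -- two points to delete.
  subst (λ l → Colorable (Kneser (8 + l) (4 + j) 1) c) (sym (+-suc j j))
    (pullback (stahl-homomorphism (s≤s (s≤s z≤n)) (+-mono-≤ (m≤m+n 3 4) (m≤m+n j j)))
      (kneser-7-3-1-bounds col j))

johnson⇒kneser : i < k → Homomorphism (Johnson n k i) (Kneser n k i)
johnson⇒kneser i<k = (λ x → x) , λ (x , x≡) (y , _) xy≡i →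
  (λ { refl → <⇒≢ i<k (trans (sym xy≡i) (trans (cong ∣_∣ (∩-idem x)) x≡)) }) ,
  ≤-reflexive xy≡i

-- Edges uv and uw of K₅ go to distinct translates of the difference set
-- {0, 1, 3} mod 7, because u + v ≢ u + w; translates meet in one point.
edgeLine : Subset 5 → Subset 7
edgeLine x = iterate rotate (inside ∷ inside ∷ outside ∷ inside ∷ ∅) (elementSum 0 x)
  where
  rotate : ∀ {n} → Subset n → Subset n
  rotate [] = []
  rotate (s ∷ x) = x ∷ʳ s
  elementSum : ∀ {n} → ℕ → Subset n → ℕ
  elementSum l [] = 0
  elementSum l (true ∷ x) = l + elementSum (suc l) x
  elementSum l (false ∷ x) = elementSum (suc l) x

johnson-5-2-1⇒kneser-7-3-1 : Homomorphism (Johnson 5 2 1) (Kneser 7 3 1)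
johnson-5-2-1⇒kneser-7-3-1 =
  (λ (x , _) → edgeLine x , ∣edgeLine∣ x) ,
  λ (x , x≡) (y , y≡) xy → decidable-stable (adjacent? x y) λ ¬adj →
    no-bad-pair (x , y , (x≡ , y≡ , xy) , ¬adj)
  where
  Adjacent : Subset 5 → Subset 5 → Set
  Adjacent x y = edgeLine x ≢ edgeLine y × ∣ edgeLine x ∩ edgeLine y ∣ ≤ 1

  adjacent? : ∀ x y → Dec (Adjacent x y)
  adjacent? x y = ¬? (≡-dec Bool._≟_ (edgeLine x) (edgeLine y)) ×-dec (_ ≤? 1)

  ∣edgeLine∣ : ∀ x → ∣ edgeLine x ∣ ≡ 3
  ∣edgeLine∣ x = decidable-stable (_ ≟ 3) λ x≢ →
    from-no (anySubset? λ z → ¬? (∣ edgeLine z ∣ ≟ 3)) (x , x≢)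

  no-bad-pair : ¬ ∃₂ λ x y → (∣ x ∣ ≡ 2 × ∣ y ∣ ≡ 2 × ∣ x ∩ y ∣ ≡ 1) × ¬ Adjacent x y
  -- Settled by evaluating an exhaustive search over pairs of subsets of five points.
  no-bad-pair = from-no (anySubset? λ x → anySubset? λ y →
    ((∣ x ∣ ≟ 2) ×-dec (∣ y ∣ ≟ 2) ×-dec (∣ x ∩ y ∣ ≟ 1)) ×-dec ¬? (adjacent? x y))

-- The case of five points lies below the start of the Stahl chain and goes through the Fano plane
-- instead.
johnson₁-colorable : Colorable (Kneser 7 3 1) c →
  ∀ j → Colorable (Johnson (5 + (j + j)) (2 + j) 1) c
johnson₁-colorable col zero = pullback johnson-5-2-1⇒kneser-7-3-1 col
johnson₁-colorable {c} col (suc j) =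
  subst (λ l → Colorable (Johnson (6 + l) (3 + j) 1) c) (sym (+-suc j j))
    (pullback (johnson⇒kneser (s≤s (s≤s z≤n))) (kneser-7-3-1-bounds col j))

theorem4p17 : ∀ (n m : ℕ) → n ≡ 2 * m + 1 → 5 ≤ n →
    ∀ (q a b c : ℕ) →
    IsChromaticNumber (DistGraphCube n (n ∸ 3)) q →
    IsChromaticNumber (Johnson n (m ∸ 1) 0) a →
    IsChromaticNumber (Johnson n m 1) b →
    IsChromaticNumber (Kneser 7 3 1) c →
    (q ≤ a + b + 1) × (a + b + 1 ≤ c + 6)
theorem4p17 _ 0 refl (s≤s ())
theorem4p17 _ 1 refl (s≤s (s≤s (s≤s ())))
-- With `m = 2 + j`, the parameter `k` of the cube colouring is `suc j`.
theorem4p17 n (suc (suc j)) n≡2m+1 _ q a b c (_ , q-min) (A , a-min) (B , b-min) (C , _) =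
  bound (trans n≡2m+1 (normalise j)) q-min A a-min B b-min
  where
  normalise : ∀ j → 2 * (2 + j) + 1 ≡ 5 + (j + j)
  normalise = solve-∀

  swap : ∀ c → 5 + c + 1 ≡ c + 6
  swap = solve-∀

  bound : n ≡ 5 + (j + j) →
    (∀ l → Colorable (DistGraphCube n (n ∸ 3)) l → q ≤ l) →
    Colorable (Johnson n (suc j) 0) a → (∀ l → Colorable (Johnson n (suc j) 0) l → a ≤ l) →
    Colorable (Johnson n (2 + j) 1) b → (∀ l → Colorable (Johnson n (2 + j) 1) l → b ≤ l) →
    (q ≤ a + b + 1) × (a + b + 1 ≤ c + 6)
  bound refl q-min A a-min B b-min =
    q-min _ (subst (λ l → Colorable (DistGraphCube (5 + (j + j)) l) (a + b + 1)) 2k≡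
      (CubeColouring.cube-colorable (cong (3 +_) (sym 2k≡)) A B)) ,
    subst (a + b + 1 ≤_) (swap c)
      -- Minimality of `a` and `b` turns the two explicit colourings into `a ≤ 5` and `b ≤ c`.
      (+-monoˡ-≤ 1 (+-mono-≤ (a-min 5 (kneser-5-colorable j)) (b-min c (johnson₁-colorable C j))))
    where
    2k≡ : suc j + suc j ≡ 2 + (j + j)
    2k≡ = cong suc (+-suc j j)
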